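{- Let $A$, $B$, $C$ be well-founded binary relations on a set $V$. Suppose that $$BA \,\cup\, CA \,\cup\, CB \;\subseteq\; A\cup B\cup C .$$ Then the union $A\cup B\cup C$ is well-founded.
   Context: A binary relation $R$ on $V$ is called well-founded if there is no infinite forward-pointing path, i.e. no infinite sequence $x_0,x_1,x_2,\dots$ of (not necessarily distinct) elements of $V$ with $x_i \mathrel{R} x_{i+1}$ for all $i\ge 0$. Juxtaposition denotes composition of relations read from left to right: $x \mathrel{(RS)} z$ iff there is $y\in V$ with $x\mathrel{R}y$ and $y\mathrel{S}z$. -}

module Defs where

open import Data.Nat.Base using (ℕ)
open import Data.Product.Base using (∃)
open import Function.Base using (flip)
open import Induction.InfiniteDescent using (InfiniteDescendingSequence)
open import Level using (Level; _⊔_)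
open import Relation.Binary.Core using (Rel)
open import Relation.Nullary.Negation.Core using (¬_)

private
  variable
    v ℓ : Level

-- Not the accessibility predicate of Induction.WellFounded: here
-- well-foundedness is the absence of infinite paths, and the paths point
-- forwards.  InfiniteDescendingSequence (flip R) x unfolds to
-- ∀ i → R (x i) (x (suc i)).

WellFounded : {V : Set v} → Rel V ℓ → Set (v ⊔ ℓ)
WellFounded {V = V} R = ¬ ∃ λ (x : ℕ → V) → InfiniteDescendingSequence (flip R) x

{-# OPTIONS --safe #-}

-- Suppose every point of a nonempty T has an (R ∪ S)-successor in T, where R is
-- well-founded and SR ⊆ R ∪ S on T.  Then the points of T without an R-successor
-- in T form a nonempty set T′ in which every point has an S-successor: the
-- successor in T of a point x ∈ T′ is an S-successor, and moving it along
-- R-steps inside T as long as possible keeps it an S-successor of x.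
--
-- Starting from the set of points on infinite (A ∪ B ∪ C)-paths, apply this with
-- (R, S) = (A, B ∪ C) and then with (R, S) = (B, C).  What remains is a nonempty
-- set in which every point has a C-successor, so C is not well-founded.
module Submission where

open import Axiom.ExcludedMiddle using (ExcludedMiddle)
open import Level using (Level; _⊔_)
open import Relation.Binary.Core using (Rel; _⇒_)
open import Relation.Binary.Construct.Composition using (_;_)
open import Relation.Binary.Construct.Union using (_∪_)
open import Defs

open import Data.Nat.Base using (suc)
open import Data.Nat.GeneralisedArithmetic using (fold)
open import Data.Product.Base using (∃; _×_; _,_; proj₁; proj₂)
open import Data.Sum.Base using (inj₁; inj₂; fromInj₂)
open import Function.Base using (_∘_; flip)
open import Induction.InfiniteDescent
  using (Descent; InfiniteDescendingSequenceFrom)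
open import Relation.Binary.PropositionalEquality.Core using (refl)
open import Relation.Nullary.Decidable.Core using (decidable-stable)
open import Relation.Nullary.Negation.Core using (¬_; contradiction)
open import Relation.Unary using (Pred; _∩_; Satisfiable)

private
  variable
    v ℓ p : Level
    V : Set v

Terminal : Rel V ℓ → Pred V p → Pred V _
Terminal R T x = T x × (∀ y → R x y → ¬ T y)

descent⇒¬wellFounded : {R : Rel V ℓ} {T : Pred V p} →
                       Descent (flip R) T → Satisfiable T → ¬ WellFounded R
descent⇒¬wellFounded {T = T} next start wf =
  wf (proj₁ ∘ path , λ i → proj₁ (proj₂ (next (proj₂ (path i)))))
  where
  step : ∃ T → ∃ T
  step (_ , tx) with y , _ , ty ← next tx = y , ty

  path = fold start step

OnInfinitePath : {V : Set v} → Rel V ℓ → Pred V (v ⊔ ℓ)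
OnInfinitePath R x = ∃ λ f → InfiniteDescendingSequenceFrom (flip R) f x

onInfinitePath-descent : (R : Rel V ℓ) → Descent (flip R) (OnInfinitePath R)
onInfinitePath-descent R (f , refl , path) =
  f 1 , path 0 , f ∘ suc , refl , path ∘ suc

module _ {v ℓ : Level} (em : ExcludedMiddle (v ⊔ ℓ)) {V : Set v}
         {R : Rel V ℓ} (wf : WellFounded R) where

  -- Were no point of `T` terminal, each would have an `R`-successor in `T`, and following these
  -- forever would contradict `wf`.
  wellFounded⇒terminal : {T : Pred V (v ⊔ ℓ)} →
                         Satisfiable T → Satisfiable (Terminal R T)
  wellFounded⇒terminal {T} start = decidable-stable em λ none →
    descent⇒¬wellFounded {R = R} {T = T}
      (λ {x} tx → decidable-stable em λ stuck →
        none (x , tx , λ y xRy ty → stuck (y , xRy , ty)))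
      start wf

  -- The inclusion is asked only on `T` because the second use, with `R = B`, derives it only
  -- between points of `T₁`.
  terminal-descent : {S : Rel V ℓ} {T : Pred V (v ⊔ ℓ)} →
                     Descent (flip (R ∪ S)) T →
                     (∀ {x z} → T x → T z → (S ; R) x z → (R ∪ S) x z) →
                     Descent (flip S) (Terminal R T)
  terminal-descent {S} {T} next SR⊆R∪S {x} (tx , x-terminal)
    with y , xRSy , ty ← next tx
    -- By `SR⊆R∪S`, an `R`-step from `z` to some `w` in `T` would stay in `T ∩ S x`, so `z`,
    -- terminal there, is terminal in `T` too.
    = let z , (tz , xSz) , z-terminal =
            wellFounded⇒terminal {T = T ∩ S x} (y , ty , notR ty xRSy)
      in z , xSz , tz , λ w zRw tw →
           z-terminal w zRw (tw , notR tw (SR⊆R∪S tx tw (z , xSz , zRw)))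
    where
    notR : ∀ {w} → T w → (R ∪ S) x w → S x w
    notR tw = fromInj₂ λ xRw → contradiction tw (x-terminal _ xRw)

theorem2 : ∀ {v ℓ : Level} → ExcludedMiddle (v ⊔ ℓ) →
    (V : Set v) (A B C : Rel V ℓ) →
    WellFounded A → WellFounded B → WellFounded C →
    ((B ; A) ∪ (C ; A) ∪ (C ; B)) ⇒ (A ∪ B ∪ C) →
    WellFounded (A ∪ B ∪ C)
theorem2 {v} {ℓ} em V A B C wfA wfB wfC jump (f , path) =
  descent⇒¬wellFounded {R = C} {T = T₂} T₂-descent
    (wellFounded⇒terminal em wfB (wellFounded⇒terminal em wfA (f 0 , f , refl , path)))
    wfC
  where
  T₀ T₁ T₂ : Pred V (v ⊔ ℓ)
  T₀ = OnInfinitePath (A ∪ B ∪ C)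
  T₁ = Terminal A T₀
  T₂ = Terminal B T₁

  T₁-descent : Descent (flip (B ∪ C)) T₁
  T₁-descent = terminal-descent em wfA (onInfinitePath-descent (A ∪ B ∪ C)) λ where
    _ _ (y , inj₁ xBy , yAz) → jump (inj₁ (y , xBy , yAz))
    _ _ (y , inj₂ xCy , yAz) → jump (inj₂ (inj₁ (y , xCy , yAz)))

  T₂-descent : Descent (flip C) T₂
  T₂-descent = terminal-descent em wfB T₁-descent λ
    (_ , x-terminal) (tz , _) xCBz →
      -- The case `A x z` is impossible: `x` is `A`-terminal in `T₀`, which contains `z`.
      fromInj₂ (λ xAz → contradiction tz (x-terminal _ xAz))
               (jump (inj₂ (inj₂ xCBz)))
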